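{- Let $D=(E,\mathcal F)$ be a vf-safe delta-matroid, and let $S\subseteq E$. Then there exists $A\subseteq S$, with an ordering $e_1,\ldots,e_k$ of the elements of $A$, such that $$\omega(D^{\times|A})=\max_{B\subseteq S}\omega(D^{\times|B}),$$ and the sequence $$\omega(D),\ \omega(D^{\times|\{e_1\}}),\ \omega(D^{\times|\{e_1,e_2\}}),\ \ldots,\ \omega(D^{\times|A})$$ is non-decreasing.
   Context: A set system is a pair $D=(E,\mathcal F)$ with $E$ a finite set and $\mathcal F\subseteq 2^E$; the members of $\mathcal F$ are the feasible sets. $D$ is proper if $\mathcal F\neq\emptyset$. A delta-matroid is a proper set system such that for all $X,Y\in\mathcal F$ and every $u\in X\triangle Y$ there exists $v\in X\triangle Y$ (possibly $v=u$) with $X\triangle\{u,v\}\in\mathcal F$, where $\triangle$ is symmetric difference. For proper $D$, $r(D_{\max})$ and $r(D_{\min})$ denote the largest and smallest cardinality of a feasible set, and the width is $\omega(D)=r(D_{\max})-r(D_{\min})$. Twist: for $A\subseteq E$, $D^{\ast|A}=(E,\{F\triangle A\mid F\in\mathcal F\})$. Loop complementation: for $e\in E$, $D^{\times|e}=(E,\mathcal F')$ with $\mathcal F'=\mathcal F\,\triangle\,\{F\cup\{e\}\mid F\in\mathcal F,\ e\notin F\}$. Loop complementations on distinct elements commute, and for $A\subseteq E$, $D^{\times|A}$ is obtained by applying loop complementation to every element of $A$ (so $D^{\times|\emptyset}=D$). These operations preserve properness. A delta-matroid $D$ is vf-safe if every set system obtained from $D$ by an arbitrary finite sequence of twists and loop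 complementations (on elements or subsets of $E$) is again a delta-matroid. -}

module Defs where

open import Data.Fin.Base using (Fin)
open import Data.Fin.Subset
  using (Subset; inside; outside; _∈_; _∉_; _∪_; _─_; ⋃; ⁅_⁆; ∣_∣)
open import Data.Fin.Subset.Properties using (_∈?_; _⊆?_; anySubset?)
open import Data.List.Base using (List; []; _∷_; _++_; map; filter; foldl; allFin)
open import Data.List.Extrema.Nat using (max; min)
open import Data.List.Relation.Unary.Unique.Propositional using (Unique)
import Data.Bool.Properties as Bool
open import Data.Nat.Base using (ℕ; zero; suc; _∸_)
open import Data.Product.Base using (∃; ∃-syntax; _×_)
open import Data.Sum.Base using (_⊎_)
import Data.Vec.Base as Vec
import Data.Vec.Properties as Vec
open import Level using (0ℓ)
open import Relation.Binary.Definitions using (DecidableEquality)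
open import Relation.Binary.PropositionalEquality.Core using (_≡_)
open import Relation.Nullary.Decidable.Core using (¬?; _×-dec_; _⊎-dec_)
open import Relation.Nullary.Negation.Core using (¬_)
open import Relation.Unary using (Pred; Decidable)

private
  variable
    n : ℕ

infix 4 _≟ˢ_
_≟ˢ_ : DecidableEquality (Subset n)
_≟ˢ_ = Vec.≡-dec Bool._≟_

infixl 6 _△_
_△_ : Subset n → Subset n → Subset n
X △ Y = (X ─ Y) ∪ (Y ─ X)

-- The ground set is Fin n.  A family of subsets of a finite set is a decidable
-- predicate; decidability is what makes the cardinality extrema computable.
record SetSystem (n : ℕ) : Set₁ where
  field
    Feasible  : Pred (Subset n) 0ℓ
    feasible? : Decidable Feasible

open SetSystem public

Proper : SetSystem n → Set
Proper D = ∃ (Feasible D)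

record IsDeltaMatroid {n : ℕ} (D : SetSystem n) : Set where
  field
    proper   : Proper D
    exchange : ∀ {X Y} → Feasible D X → Feasible D Y → ∀ {u} → u ∈ X △ Y →
               ∃[ v ] v ∈ X △ Y × Feasible D (X △ (⁅ u ⁆ ∪ ⁅ v ⁆))

subsets : ∀ n → List (Subset n)
subsets zero    = Vec.[] ∷ []
subsets (suc n) =
  map (outside Vec.∷_) (subsets n) ++ map (inside Vec.∷_) (subsets n)

feasibleSizes : SetSystem n → List ℕ
feasibleSizes {n} D = map ∣_∣ (filter (feasible? D) (subsets n))

-- In rMax and rMin the first argument of max/min is the value on the empty
-- list.  All sizes lie between 0 and n, so it does not affect proper systems.
rMax : SetSystem n → ℕ
rMax D = max 0 (feasibleSizes D)

rMin : SetSystem n → ℕ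
rMin {n} D = min n (feasibleSizes D)

-- For proper D, rMin D ≤ rMax D, so the subtraction is not truncated.
width : SetSystem n → ℕ
width D = rMax D ∸ rMin D

infixl 8 _*∣_ _×∣ₑ_ _×∣_

_*∣_ : SetSystem n → Subset n → SetSystem n
(D *∣ A) .Feasible  X = ∃[ F ] Feasible D F × X ≡ F △ A
(D *∣ A) .feasible? X = anySubset? λ F → feasible? D F ×-dec (X ≟ˢ F △ A)

-- The family { F ∪ {e} ∣ F feasible, e ∉ F }.
Extended : SetSystem n → Fin n → Pred (Subset n) 0ℓ
Extended D e X = ∃[ F ] Feasible D F × e ∉ F × X ≡ F ∪ ⁅ e ⁆

extended? : (D : SetSystem n) (e : Fin n) → Decidable (Extended D e)
extended? D e X =
  anySubset? λ F → feasible? D F ×-dec ¬? (e ∈? F) ×-dec (X ≟ˢ F ∪ ⁅ e ⁆)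

_×∣ₑ_ : SetSystem n → Fin n → SetSystem n
(D ×∣ₑ e) .Feasible  X = (Feasible D X × ¬ Extended D e X) ⊎
                         (Extended D e X × ¬ Feasible D X)
(D ×∣ₑ e) .feasible? X = (feasible? D X ×-dec ¬? (extended? D e X)) ⊎-dec
                         (extended? D e X ×-dec ¬? (feasible? D X))

-- Loop complementations on distinct elements commute, so applying them in
-- increasing order of the elements of A is no restriction.
_×∣_ : SetSystem n → Subset n → SetSystem n
_×∣_ {n} D A = foldl _×∣ₑ_ D (filter (_∈? A) (allFin n))

data Reachable {n : ℕ} (D : SetSystem n) : SetSystem n → Set₁ where
  start    : Reachable D D
  twist    : ∀ {D′} → Reachable D D′ → ∀ A → Reachable D (D′ *∣ A)
  loopElem : ∀ {D′} → Reachable D D′ → ∀ e → Reachable D (D′ ×∣ₑ e)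
  loopSet  : ∀ {D′} → Reachable D D′ → ∀ A → Reachable D (D′ ×∣ A)

record IsVfSafeDeltaMatroid {n : ℕ} (D : SetSystem n) : Set₁ where
  field
    isDeltaMatroid : IsDeltaMatroid D
    vfSafe         : ∀ {D′} → Reachable D D′ → IsDeltaMatroid D′

fromList : List (Fin n) → Subset n
fromList es = ⋃ (map ⁅_⁆ es)

IsOrderingOf : List (Fin n) → Subset n → Set
IsOrderingOf es A = Unique es × fromList es ≡ A

-- The maximum of ω(D ×∣ B) over B ⊆ S; since B = ∅ always occurs, the value 0
-- for the empty list plays no role.
maxLoopWidth : SetSystem n → Subset n → ℕ
maxLoopWidth {n} D S =
  max 0 (map (λ B → width (D ×∣ B)) (filter (_⊆? S) (subsets n)))

{-# OPTIONS --safe #-}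
-- Loop complementation never changes the smallest size of a feasible set, so
-- only the largest size matters.  If F is a feasible set of maximum size and
-- e ∉ F, then F ∪ {e} is one of D ×∣ₑ e, because F is feasible and F ∪ {e} is
-- too large to be; hence F ∪ B has maximum size in D ×∣ B for each B disjoint
-- from F, and the width grows along every ordering of A = S ─ F.  Conversely,
-- for B ⊆ S each feasible set of D ×∣ B lies in G ∪ S for some G feasible in D.
-- Take G with ∣ G ∪ S ∣ maximum: by the exchange axiom G extends to a feasible
-- F of maximum size, and then F ∪ A = F ∪ S attains the bound.
module Submission where

open import Defs
open import Data.Nat.Base using (ℕ; suc; _∸_; _≤_; _<_; z≤n; s≤s)
import Data.Nat.Properties as ℕ
open import Data.Fin.Base using (Fin; zero; suc)
open import Data.Fin.Subset
  using (Subset; inside; outside; _∈_; _∉_; _⊆_; _⊂_; _∪_; _∩_; _─_; ⁅_⁆; ∣_∣)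
open import Data.Fin.Subset.Properties
open import Data.List.Base using (List; []; _∷_; map; inits; filter; foldl; allFin)
import Data.List.Properties as List
open import Data.List.Extrema.Nat
open import Data.List.Membership.Propositional using () renaming (_∈_ to _∈ₗ_)
open import Data.List.Membership.Propositional.Properties
  using (∈-map⁺; ∈-++⁺ˡ; ∈-++⁺ʳ; ∈-filter⁺; ∈-allFin)
open import Data.List.Relation.Binary.Sublist.Propositional
  using (_∷_; lookup; minimum) renaming (_⊆_ to _⊑_)
open import Data.List.Relation.Unary.All as All using (All; []; _∷_)
import Data.List.Relation.Unary.All.Properties as All
open import Data.List.Relation.Unary.Any using (here; there)
open import Data.List.Relation.Unary.Linked as Linked using (Linked; [-]; _∷_)
import Data.List.Relation.Unary.Linked.Properties as Linked
open import Data.List.Relation.Unary.Unique.Propositional using (Unique; _∷_)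
import Data.List.Relation.Unary.Unique.Propositional.Properties as Unique
open import Data.Product.Base using (Σ-syntax; ∃-syntax; _×_; _,_; proj₁; proj₂)
open import Data.Sum.Base using (_⊎_; inj₁; inj₂; [_,_]′)
open import Data.Vec.Base using ([]; _∷_; here; there)
open import Function.Base using (_∘_)
open import Level using (0ℓ)
open import Relation.Binary.PropositionalEquality.Core
  using (_≡_; refl; sym; trans; cong; cong₂; subst)
open import Relation.Nullary.Decidable.Core using (yes; no; _×-dec_)
open import Relation.Nullary.Negation.Core using (¬_; contradiction)
open import Relation.Unary using (Pred; Decidable)

private
  variable
    n : ℕ

-- Elementary facts on differences, unions and cardinalities

x∈p─q⇒x∉q : ∀ (p q : Subset n) {x} → x ∈ p ─ q → x ∉ q
x∈p─q⇒x∉q (_ ∷ p) (outside ∷ q) (there x∈) (there x∈q) = x∈p─q⇒x∉q p q x∈ x∈q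
x∈p─q⇒x∉q (_ ∷ p) (inside ∷ q) (there x∈) (there x∈q) = x∈p─q⇒x∉q p q x∈ x∈q

x∈p△q⁻ : ∀ (p q : Subset n) {x} → x ∈ p △ q → (x ∈ p × x ∉ q) ⊎ (x ∈ q × x ∉ p)
x∈p△q⁻ p q x∈ with x∈p∪q⁻ (p ─ q) (q ─ p) x∈
... | inj₁ x∈p─q = inj₁ (p─q⊆p p q x∈p─q , x∈p─q⇒x∉q p q x∈p─q)
... | inj₂ x∈q─p = inj₂ (p─q⊆p q p x∈q─p , x∈p─q⇒x∉q q p x∈q─p)

x∈p∧x∉q⇒x∈p△q : ∀ {p q : Subset n} {x} → x ∈ p → x ∉ q → x ∈ p △ q
x∈p∧x∉q⇒x∈p△q x∈p x∉q = x∈p∪q⁺ (inj₁ (x∈p∧x∉q⇒x∈p─q x∈p x∉q))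

x∈q∧x∉p⇒x∈p△q : ∀ {p q : Subset n} {x} → x ∈ q → x ∉ p → x ∈ p △ q
x∈q∧x∉p⇒x∈p△q x∈q x∉p = x∈p∪q⁺ (inj₂ (x∈p∧x∉q⇒x∈p─q x∈q x∉p))

∪-lub : ∀ {p q r : Subset n} → p ⊆ r → q ⊆ r → p ∪ q ⊆ r
∪-lub {p = p} {q} p⊆r q⊆r = [ p⊆r , q⊆r ]′ ∘ x∈p∪q⁻ p q

⁅x⁆⊆p : ∀ {p : Subset n} {x} → x ∈ p → ⁅ x ⁆ ⊆ p
⁅x⁆⊆p {x = x} x∈p y∈ with refl ← x∈⁅y⁆⇒x≡y x y∈ = x∈p

p∪-monoʳ : ∀ (p : Subset n) {q r} → q ⊆ r → p ∪ q ⊆ p ∪ r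
p∪-monoʳ p {r = r} q⊆r = ∪-lub (p⊆p∪q r) (q⊆p∪q p r ∘ q⊆r)

p∪-monoˡ : ∀ (p : Subset n) {q r} → q ⊆ r → q ∪ p ⊆ r ∪ p
p∪-monoˡ p {r = r} q⊆r = ∪-lub (p⊆p∪q p ∘ q⊆r) (q⊆p∪q r p)

p∪[q─p]≡p∪q : ∀ (p q : Subset n) → p ∪ (q ─ p) ≡ p ∪ q
p∪[q─p]≡p∪q p q = ⊆-antisym (p∪-monoʳ p (p─q⊆p q p)) (∪-lub (p⊆p∪q _) q⊆)
  where
  q⊆ : q ⊆ p ∪ (q ─ p)
  q⊆ {x} x∈q with x ∈? p
  ... | yes x∈p = x∈p∪q⁺ (inj₁ x∈p)
  ... | no  x∉p = x∈p∪q⁺ (inj₂ (x∈p∧x∉q⇒x∈p─q x∈q x∉p))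

x∉p⇒∣p∣<∣p∪⁅x⁆∣ : ∀ {p : Subset n} {x} → x ∉ p → ∣ p ∣ < ∣ p ∪ ⁅ x ⁆ ∣
x∉p⇒∣p∣<∣p∪⁅x⁆∣ {x = x} x∉p =
  p⊂q⇒∣p∣<∣q∣ (p⊆p∪q _ , x , x∈p∪q⁺ (inj₂ (x∈⁅x⁆ x)) , x∉p)

∣p∪⁅x⁆∣≤1+∣p∣ : ∀ (p : Subset n) x → ∣ p ∪ ⁅ x ⁆ ∣ ≤ suc ∣ p ∣
∣p∪⁅x⁆∣≤1+∣p∣ (outside ∷ p) zero rewrite ∪-identityʳ p = ℕ.≤-refl
∣p∪⁅x⁆∣≤1+∣p∣ (inside ∷ p)  zero rewrite ∪-identityʳ p = ℕ.n≤1+n _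
∣p∪⁅x⁆∣≤1+∣p∣ (outside ∷ p) (suc x) = ∣p∪⁅x⁆∣≤1+∣p∣ p x
∣p∪⁅x⁆∣≤1+∣p∣ (inside ∷ p)  (suc x) = s≤s (∣p∪⁅x⁆∣≤1+∣p∣ p x)

-- Members of extreme value in a decidable family

∈-subsets : ∀ (p : Subset n) → p ∈ₗ subsets n
∈-subsets []            = here refl
∈-subsets (outside ∷ p) = ∈-++⁺ˡ (∈-map⁺ _ (∈-subsets p))
∈-subsets (inside ∷ p)  = ∈-++⁺ʳ _ (∈-map⁺ _ (∈-subsets p))

module _ {P : Pred (Subset n) 0ℓ} (P? : Decidable P) (f : Subset n → ℕ) where

  -- The known member `p` serves as the starting value of `argmax`, so the result is certain to
  -- satisfy `P`.
  maximiser : ∀ {p} → P p → ∃[ q ] P q × (∀ {r} → P r → f r ≤ f q)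
  maximiser {p} Pp = argmax f p ps
                   , argmax-all f Pp (All.all-filter P? (subsets n))
                   , λ Pr → All.lookup (f[xs]≤f[argmax] p ps) (∈-filter⁺ P? (∈-subsets _) Pr)
    where ps = filter P? (subsets n)

  minimiser : ∀ {p} → P p → ∃[ q ] P q × (∀ {r} → P r → f q ≤ f r)
  minimiser {p} Pp = argmin f p ps
                   , argmin-all f Pp (All.all-filter P? (subsets n))
                   , λ Pr → All.lookup (f[argmin]≤f[xs] p ps) (∈-filter⁺ P? (∈-subsets _) Pr)
    where ps = filter P? (subsets n)

-- Lists and the subsets they enumerate

∈-fromList⁺ : ∀ {xs : List (Fin n)} {x} → x ∈ₗ xs → x ∈ fromList xs
∈-fromList⁺ {x = x} (here refl) = x∈p∪q⁺ (inj₁ (x∈⁅x⁆ x))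
∈-fromList⁺ (there x∈xs)        = x∈p∪q⁺ (inj₂ (∈-fromList⁺ x∈xs))

∈-fromList⁻ : ∀ (xs : List (Fin n)) {x} → x ∈ fromList xs → x ∈ₗ xs
∈-fromList⁻ [] x∈ = contradiction x∈ ∉⊥
∈-fromList⁻ (y ∷ xs) x∈ with x∈p∪q⁻ ⁅ y ⁆ (fromList xs) x∈
... | inj₁ x∈⁅y⁆ = here (x∈⁅y⁆⇒x≡y y x∈⁅y⁆)
... | inj₂ x∈xs  = there (∈-fromList⁻ xs x∈xs)

-- This is the very list that `_×∣_` folds over, so `D ×∣ p` is `foldl _×∣ₑ_ D (elements p)` by
-- definition.
elements : Subset n → List (Fin n)
elements {n} p = filter (_∈? p) (allFin n)

elements-unique : ∀ (p : Subset n) → Unique (elements p)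
elements-unique {n} p = Unique.filter⁺ (_∈? p) (Unique.allFin⁺ n)

elements-all : ∀ (p : Subset n) → All (_∈ p) (elements p)
elements-all {n} p = All.all-filter (_∈? p) (allFin n)

fromList-elements : ∀ (p : Subset n) → fromList (elements p) ≡ p
fromList-elements p = ⊆-antisym
  (All.lookup (elements-all p) ∘ ∈-fromList⁻ (elements p))
  (∈-fromList⁺ ∘ ∈-filter⁺ (_∈? p) (∈-allFin _))

fromList-mono : ∀ {xs ys : List (Fin n)} → xs ⊑ ys → fromList xs ⊆ fromList ys
fromList-mono {xs = xs} xs⊑ys = ∈-fromList⁺ ∘ lookup xs⊑ys ∘ ∈-fromList⁻ xs

inits-linked : ∀ {A : Set} (xs : List A) → Linked _⊑_ (inits xs)
inits-linked []       = [-]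
inits-linked (x ∷ xs) = minimum _ ∷ Linked.map⁺ (Linked.map (refl ∷_) (inits-linked xs))

-- Feasible sets of extreme cardinality

IsLargest IsSmallest : SetSystem n → Subset n → Set
IsLargest  D F = Feasible D F × (∀ {G} → Feasible D G → ∣ G ∣ ≤ ∣ F ∣)
IsSmallest D F = Feasible D F × (∀ {G} → Feasible D G → ∣ F ∣ ≤ ∣ G ∣)

module _ (D : SetSystem n) where

  ∈-feasibleSizes : ∀ {F} → Feasible D F → ∣ F ∣ ∈ₗ feasibleSizes D
  ∈-feasibleSizes DF = ∈-map⁺ ∣_∣ (∈-filter⁺ (feasible? D) (∈-subsets _) DF)

  all-feasibleSizes : ∀ {P : Pred ℕ 0ℓ} → (∀ {F} → Feasible D F → P ∣ F ∣) →
                      All P (feasibleSizes D)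
  all-feasibleSizes p = All.map⁺ (All.map p (All.all-filter (feasible? D) (subsets n)))

  rMax-largest : ∀ {F} → IsLargest D F → rMax D ≡ ∣ F ∣
  rMax-largest (DF , F-max) = max≈v⁺ (∈-feasibleSizes DF) (all-feasibleSizes F-max) z≤n

  rMin-smallest : ∀ {F} → IsSmallest D F → rMin D ≡ ∣ F ∣
  rMin-smallest {F} (DF , F-min) =
    -- The last argument shows that the default value `n` of `min` cannot undercut `∣ F ∣`.
    min≈v⁺ (∈-feasibleSizes DF) (all-feasibleSizes F-min) (∣p∣≤n F)

-- A consequence of the exchange axiom

module _ {D : SetSystem n} (dm : IsDeltaMatroid D) where
  open IsDeltaMatroid dm

  -- Among the largest feasible sets, one that meets X in the most elements
  -- contains X: otherwise exchanging some u ∈ X ─ Y into Y would either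
  -- enlarge Y or swap u for an element outside X.
  largest-above : ∀ {X} → Feasible D X → ∃[ Y ] IsLargest D Y × X ⊆ Y
  largest-above {X} DX
    with M , DM , M-max ← maximiser (feasible? D) ∣_∣ DX
    with Y , (DY , M≤Y) , Y-max ←
         maximiser (λ Z → feasible? D Z ×-dec ∣ M ∣ ℕ.≤? ∣ Z ∣) (λ Z → ∣ X ∩ Z ∣) (DM , ℕ.≤-refl)
    = Y , (DY , ≤∣Y∣) , X⊆Y
    where
    ≤∣Y∣ : ∀ {G} → Feasible D G → ∣ G ∣ ≤ ∣ Y ∣
    ≤∣Y∣ DG = ℕ.≤-trans (M-max DG) M≤Y

    X⊆Y : X ⊆ Y
    X⊆Y {u} u∈X with u ∈? Y
    ... | yes u∈Y = u∈Y
    ... | no  u∉Y with v , v∈ , DZ ← exchange DY DX (x∈q∧x∉p⇒x∈p△q u∈X u∉Y) =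
      case (x∈p△q⁻ Y X v∈)
      where
      Z = Y △ (⁅ u ⁆ ∪ ⁅ v ⁆)

      u∈Z : u ∈ Z
      u∈Z = x∈q∧x∉p⇒x∈p△q (x∈p∪q⁺ (inj₁ (x∈⁅x⁆ u))) u∉Y

      w∈Z : ∀ {w} → w ∈ Y → w ∉ ⁅ v ⁆ → w ∈ Z
      w∈Z w∈Y w∉v = x∈p∧x∉q⇒x∈p△q w∈Y
        ([ (λ w∈u → u∉Y (subst (_∈ Y) (x∈⁅y⁆⇒x≡y u w∈u) w∈Y)) , w∉v ]′ ∘ x∈p∪q⁻ ⁅ u ⁆ ⁅ v ⁆)

      case : (v ∈ Y × v ∉ X) ⊎ (v ∈ X × v ∉ Y) → u ∈ Y
      -- `Z` is no smaller than `Y`, and it meets `X` also in `u` while losing only `v ∉ X`, against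
      -- the choice of `Y`.
      case (inj₁ (v∈Y , v∉X)) = contradiction
        (Y-max (DZ , ℕ.≤-trans M≤Y ∣Y∣≤∣Z∣)) (ℕ.<⇒≱ (p⊂q⇒∣p∣<∣q∣ X∩Y⊂X∩Z))
        where
        -- Only `v` can have left `Y`, and `u` has entered; hence
        -- `∣ Y ∣ + 1 ≤ ∣ Z ∪ ⁅ v ⁆ ∣ ≤ ∣ Z ∣ + 1`.
        Y∪u⊆Z∪v : Y ∪ ⁅ u ⁆ ⊆ Z ∪ ⁅ v ⁆
        Y∪u⊆Z∪v = ∪-lub Y⊆ (p⊆p∪q _ ∘ ⁅x⁆⊆p u∈Z)
          where
          Y⊆ : Y ⊆ Z ∪ ⁅ v ⁆
          Y⊆ {w} w∈Y with w ∈? ⁅ v ⁆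
          ... | yes w∈v = x∈p∪q⁺ (inj₂ w∈v)
          ... | no  w∉v = x∈p∪q⁺ (inj₁ (w∈Z w∈Y w∉v))

        ∣Y∣≤∣Z∣ : ∣ Y ∣ ≤ ∣ Z ∣
        ∣Y∣≤∣Z∣ = ℕ.≤-pred (ℕ.≤-trans (x∉p⇒∣p∣<∣p∪⁅x⁆∣ u∉Y)
          (ℕ.≤-trans (p⊆q⇒∣p∣≤∣q∣ Y∪u⊆Z∪v) (∣p∪⁅x⁆∣≤1+∣p∣ Z v)))

        X∩Y⊂X∩Z : X ∩ Y ⊂ X ∩ Z
        X∩Y⊂X∩Z = (λ w∈ → let w∈X , w∈Y = x∈p∩q⁻ X Y w∈ in
                    x∈p∩q⁺ (w∈X , w∈Z w∈Y (λ w∈v → v∉X (subst (_∈ X) (x∈⁅y⁆⇒x≡y v w∈v) w∈X))))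
                , u , x∈p∩q⁺ (u∈X , u∈Z) , u∉Y ∘ proj₂ ∘ x∈p∩q⁻ X Y
      -- Nothing is removed from `Y`, also when `v` is `u`, so `Z` properly contains the largest set
      -- `Y`.
      case (inj₂ (_ , v∉Y)) = contradiction (≤∣Y∣ DZ) (ℕ.<⇒≱ (p⊂q⇒∣p∣<∣q∣
        ((λ w∈Y → w∈Z w∈Y (λ w∈v → v∉Y (subst (_∈ Y) (x∈⁅y⁆⇒x≡y v w∈v) w∈Y)))
        , u , u∈Z , u∉Y)))

-- Loop complementation at one element

module _ (D : SetSystem n) (e : Fin n) where

  feasible-×ₑ⁻ : ∀ {X} → Feasible (D ×∣ₑ e) X → Feasible D X ⊎ Extended D e X
  feasible-×ₑ⁻ = [ inj₁ ∘ proj₁ , inj₂ ∘ proj₁ ]′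

  -- Were `F` an extension `G ∪ ⁅ e ⁆`, the feasible set `G` would be smaller; so `F` is not
  -- cancelled. Every new set contains a feasible one.
  smallest-×ₑ : ∀ {F} → IsSmallest D F → IsSmallest (D ×∣ₑ e) F
  smallest-×ₑ {F} (DF , F-min) = inj₁ (DF , F-unextended) , ≤-all ∘ feasible-×ₑ⁻
    where
    F-unextended : ¬ Extended D e F
    F-unextended (G , DG , e∉G , refl) =
      contradiction (F-min DG) (ℕ.<⇒≱ (x∉p⇒∣p∣<∣p∪⁅x⁆∣ e∉G))

    ≤-all : ∀ {X} → Feasible D X ⊎ Extended D e X → ∣ F ∣ ≤ ∣ X ∣
    ≤-all (inj₁ DX)                  = F-min DX
    ≤-all (inj₂ (G , DG , _ , refl)) = ℕ.≤-trans (F-min DG) (∣p∣≤∣p∪q∣ G ⁅ e ⁆)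

  largest-×ₑ : ∀ {F} → e ∉ F → IsLargest D F → IsLargest (D ×∣ₑ e) (F ∪ ⁅ e ⁆)
  largest-×ₑ {F} e∉F (DF , F-max) =
    inj₂ ((F , DF , e∉F , refl) , λ DF∪e → contradiction (F-max DF∪e) (ℕ.<⇒≱ ∣F∣<)) ,
    all-≤ ∘ feasible-×ₑ⁻
    where
    ∣F∣< = x∉p⇒∣p∣<∣p∪⁅x⁆∣ e∉F

    -- An extension exceeds a feasible set by at most one element, so no size passes `∣ F ∣ + 1`.
    all-≤ : ∀ {X} → Feasible D X ⊎ Extended D e X → ∣ X ∣ ≤ ∣ F ∪ ⁅ e ⁆ ∣
    all-≤ (inj₁ DX)                  = ℕ.≤-trans (F-max DX) (ℕ.<⇒≤ ∣F∣<)
    all-≤ (inj₂ (G , DG , _ , refl)) =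
      ℕ.≤-trans (∣p∪⁅x⁆∣≤1+∣p∣ G e) (ℕ.≤-trans (s≤s (F-max DG)) ∣F∣<)

  -- The only element that can be added is `e`, and `S` absorbs it.
  feasible-×ₑ-⊆ : ∀ {S X} → e ∈ S → Feasible (D ×∣ₑ e) X → ∃[ G ] Feasible D G × X ⊆ G ∪ S
  feasible-×ₑ-⊆ {S} {X} e∈S DeX with feasible-×ₑ⁻ DeX
  ... | inj₁ DX                  = X , DX , p⊆p∪q S
  ... | inj₂ (G , DG , _ , refl) = G , DG , p∪-monoʳ G (⁅x⁆⊆p e∈S)

-- Loop complementation along a list and on a subset

smallest-foldl : ∀ {D : SetSystem n} {F} es → IsSmallest D F → IsSmallest (foldl _×∣ₑ_ D es) F
smallest-foldl         []       F-min = F-min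
smallest-foldl {D = D} (e ∷ es) F-min = smallest-foldl es (smallest-×ₑ D e F-min)

-- As the entries are distinct, those still to come avoid `F ∪ ⁅ e ⁆` too, and `largest-×ₑ` applies
-- again.
largest-foldl : ∀ {D : SetSystem n} {F es} → Unique es → All (_∉ F) es → IsLargest D F →
                IsLargest (foldl _×∣ₑ_ D es) (F ∪ fromList es)
largest-foldl {D = D} {F} {[]} _ _ F-max = subst (IsLargest D) (sym (∪-identityʳ F)) F-max
largest-foldl {D = D} {F} {e ∷ es} (e≢es ∷ es!) (e∉F ∷ es∉F) F-max =
  subst (IsLargest (foldl _×∣ₑ_ (D ×∣ₑ e) es)) (∪-assoc F ⁅ e ⁆ (fromList es))
    (largest-foldl es! (All.zipWith ∉-∪ (e≢es , es∉F)) (largest-×ₑ D e e∉F F-max))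
  where
  ∉-∪ : ∀ {x} → _ × x ∉ F → x ∉ F ∪ ⁅ e ⁆
  ∉-∪ (e≢x , x∉F) = [ x∉F , e≢x ∘ sym ∘ x∈⁅y⁆⇒x≡y e ]′ ∘ x∈p∪q⁻ F ⁅ e ⁆

feasible-foldl-⊆ : ∀ {D : SetSystem n} {S X es} → All (_∈ S) es →
                   Feasible (foldl _×∣ₑ_ D es) X → ∃[ G ] Feasible D G × X ⊆ G ∪ S
feasible-foldl-⊆ {S = S} {X} [] DX = X , DX , p⊆p∪q S
feasible-foldl-⊆ {D = D} {S} {es = e ∷ _} (e∈S ∷ es∈S) DX
  with H , DeH , X⊆H∪S ← feasible-foldl-⊆ es∈S DX
  with G , DG  , H⊆G∪S ← feasible-×ₑ-⊆ D e e∈S DeH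
  = G , DG , ∪-lub H⊆G∪S (q⊆p∪q G S) ∘ X⊆H∪S

module _ {D : SetSystem n} where

  smallest-× : ∀ {F} B → IsSmallest D F → IsSmallest (D ×∣ B) F
  smallest-× B = smallest-foldl (elements B)

  largest-× : ∀ {F B} → (∀ {x} → x ∈ B → x ∉ F) → IsLargest D F → IsLargest (D ×∣ B) (F ∪ B)
  largest-× {F} {B} B∩F=∅ F-max = subst (λ C → IsLargest (D ×∣ B) (F ∪ C)) (fromList-elements B)
    (largest-foldl (elements-unique B) (All.map B∩F=∅ (elements-all B)) F-max)

  feasible-×-⊆ : ∀ {S B X} → B ⊆ S → Feasible (D ×∣ B) X → ∃[ G ] Feasible D G × X ⊆ G ∪ S
  feasible-×-⊆ {B = B} B⊆S = feasible-foldl-⊆ (All.map B⊆S (elements-all B))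

theorem4p9 : ∀ {n : ℕ} (D : SetSystem n) → IsVfSafeDeltaMatroid D → (S : Subset n) →
    Σ[ A ∈ Subset n ] Σ[ es ∈ List (Fin n) ]
    (A ⊆ S) × IsOrderingOf es A ×
    (width (D ×∣ A) ≡ maxLoopWidth D S) ×
    Linked _≤_ (map (λ p → width (D ×∣ fromList p)) (inits es))
theorem4p9 {n} D vf S
  with X , DX ← IsDeltaMatroid.proper (IsVfSafeDeltaMatroid.isDeltaMatroid vf)
  with M , M-min ← minimiser (feasible? D) ∣_∣ DX
  with G , DG , G-max ← maximiser (feasible? D) (λ H → ∣ H ∪ S ∣) DX
  with F , F-max , G⊆F ← largest-above (IsVfSafeDeltaMatroid.isDeltaMatroid vf) DG
  = A , elements A , A⊆S , (elements-unique A , fromList-elements A) , width-A , widths-linked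
  where
  A = S ─ F

  A⊆S : A ⊆ S
  A⊆S = p─q⊆p S F

  -- The exact value is available because such a `B` is disjoint from `F`.
  width-⊆A : ∀ {B} → B ⊆ A → width (D ×∣ B) ≡ ∣ F ∪ B ∣ ∸ ∣ M ∣
  width-⊆A {B} B⊆A = cong₂ _∸_
    (rMax-largest (D ×∣ B) (largest-× (x∈p─q⇒x∉q S F ∘ B⊆A) F-max))
    (rMin-smallest (D ×∣ B) (smallest-× B M-min))

  width-⊆S : ∀ {B} → B ⊆ S → width (D ×∣ B) ≤ ∣ F ∪ S ∣ ∸ ∣ M ∣
  width-⊆S {B} B⊆S rewrite rMin-smallest (D ×∣ B) (smallest-× B M-min) =
    ℕ.∸-monoˡ-≤ ∣ M ∣ (max≤v⁺ z≤n (all-feasibleSizes (D ×∣ B) ∣X∣≤))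
    where
    ∣X∣≤ : ∀ {X} → Feasible (D ×∣ B) X → ∣ X ∣ ≤ ∣ F ∪ S ∣
    -- The chain is `∣ X ∣ ≤ ∣ H ∪ S ∣ ≤ ∣ G ∪ S ∣ ≤ ∣ F ∪ S ∣`, by the choice of `G` and then `G ⊆
    -- F`.
    ∣X∣≤ DBX with H , DH , X⊆H∪S ← feasible-×-⊆ B⊆S DBX =
      ℕ.≤-trans (p⊆q⇒∣p∣≤∣q∣ X⊆H∪S)
        (ℕ.≤-trans (G-max DH) (p⊆q⇒∣p∣≤∣q∣ (p∪-monoˡ S G⊆F)))

  width-A : width (D ×∣ A) ≡ maxLoopWidth D S
  width-A = sym (max≈v⁺
    (∈-map⁺ _ (∈-filter⁺ (_⊆? S) (∈-subsets A) A⊆S))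
    (All.map⁺ (All.map {P = _⊆ S} (λ B⊆S → ℕ.≤-trans (width-⊆S B⊆S) (ℕ.≤-reflexive (sym width-A≡)))
                       (All.all-filter (_⊆? S) (subsets n))))
    z≤n)
    where
    width-A≡ : width (D ×∣ A) ≡ ∣ F ∪ S ∣ ∸ ∣ M ∣
    width-A≡ = trans (width-⊆A ⊆-refl) (cong (λ C → ∣ C ∣ ∸ ∣ M ∣) (p∪[q─p]≡p∪q F S))

  widths-linked : Linked _≤_ (map (λ p → width (D ×∣ fromList p)) (inits (elements A)))
  -- Every prefix enumerates a subset of `A`, so its width is given by `width-⊆A`; this value grows
  -- with the prefix.
  widths-linked = subst (Linked _≤_)
    (sym (List.map-cong-local (All.map prefix-width (All.inits⁺ (elements-all A)))))
    (Linked.map⁺ (Linked.map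
      (λ p⊑q → ℕ.∸-monoˡ-≤ ∣ M ∣ (p⊆q⇒∣p∣≤∣q∣ (p∪-monoʳ F (fromList-mono p⊑q))))
      (inits-linked (elements A))))
    where
    prefix-width : ∀ {p} → All (_∈ A) p → width (D ×∣ fromList p) ≡ ∣ F ∪ fromList p ∣ ∸ ∣ M ∣
    prefix-width {p} p⊆A = width-⊆A (All.lookup p⊆A ∘ ∈-fromList⁻ p)
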